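{- Let $P$ be a poset and let $\to$ be a total binary operation on $P$. Then $$x\to y=\max\{u\ge y: u\perp_y x\}\quad\text{for all }x,y\in P$$ (i.e. for all $x,y$ this maximum exists and equals $x\to y$) if and only if $\to$ is an extended sectional pseudocomplementation on $P$ and, for all $x,y\in P$, $x\to y=1_y$ whenever $y\not\le x$.
   Context: For elements of a poset $P$, $[p)=\{x: x\ge p\}$ and $[p,q]=\{x: p\le x\le q\}$ (empty if $p\not\le q$). For $x,y,p\in P$, $x\perp_p y$ means $[p,x]\cap[p,y]\subseteq\{p\}$. For $y\le x$, the pseudocomplement of $x$ in $[y)$ is the greatest $u\in[y)$ such that $y$ is the only common lower bound of $u$ and $x$ in $[y)$. A total binary operation $\to$ is an extended sectional pseudocomplementation if for all $y\le x$ the element $x\to y$ is the pseudocomplement of $x$ in $[y)$. When a poset admits such an operation, every section $[p)$ has a greatest element, denoted by $1_p$. -}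

module Defs where

open import Algebra.Core using (Op₂)
open import Data.Product using (_×_; _,_; ∃; proj₁; proj₂)
open import Level using (Level; _⊔_)
open import Relation.Binary.Bundles using (Poset)
open import Relation.Unary using (Pred; _∈_; _∩_; _⊆_; _≐_)

module SectionalPseudocomplement {c ℓ₁ ℓ₂ : Level} (P : Poset c ℓ₁ ℓ₂) where

  open Poset P

  [_⟩ : Carrier → Pred Carrier ℓ₂
  [ p ⟩ = p ≤_

  [_,_] : Carrier → Carrier → Pred Carrier ℓ₂
  [ p , q ] = λ x → p ≤ x × x ≤ q

  -- Singletons are taken with respect to the equality _≈_ of the poset;
  -- the library's ｛_｝ uses propositional equality.
  ⟦_⟧ : Carrier → Pred Carrier ℓ₁
  ⟦ p ⟧ = _≈ p

  _⊥[_]_ : Carrier → Carrier → Carrier → Set (c ⊔ ℓ₁ ⊔ ℓ₂)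
  x ⊥[ p ] y = ([ p , x ] ∩ [ p , y ]) ⊆ ⟦ p ⟧

  -- "m = max S": the maximum exists and equals m.
  IsMax : {ℓ : Level} → Pred Carrier ℓ → Carrier → Set (c ⊔ ℓ₂ ⊔ ℓ)
  IsMax S m = m ∈ S × (∀ {u} → u ∈ S → u ≤ m)

  CommonLowerBounds : (y u x : Carrier) → Pred Carrier ℓ₂
  CommonLowerBounds y u x = [ y ⟩ ∩ (λ z → z ≤ u × z ≤ x)

  -- Only meaningful for y ≤ x, which is the only case in which it is used.
  IsPseudocomplementIn[_⟩ : (y x u : Carrier) → Set (c ⊔ ℓ₁ ⊔ ℓ₂)
  IsPseudocomplementIn[ y ⟩ x =
    IsMax ([ y ⟩ ∩ (λ u → CommonLowerBounds y u x ≐ ⟦ y ⟧))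

  IsExtendedSectionalPseudocomplementation :
    Op₂ Carrier → Set (c ⊔ ℓ₁ ⊔ ℓ₂)
  IsExtendedSectionalPseudocomplementation _⇒_ =
    ∀ {x y} → y ≤ x → IsPseudocomplementIn[ y ⟩ x (x ⇒ y)

  module _ {_⇒_ : Op₂ Carrier}
           (esp : IsExtendedSectionalPseudocomplementation _⇒_) where

    section-has-greatest : ∀ p → ∃ (IsMax [ p ⟩)
    section-has-greatest p = p ⇒ p , proj₁ (proj₁ pc) , λ p≤u →
      proj₂ pc
        ( p≤u
        , (λ (p≤z , _ , z≤p) → antisym z≤p p≤z)
        , (λ z≈p → reflexive (Eq.sym z≈p)
                 , trans (reflexive z≈p) p≤u
                 , reflexive z≈p)
        )
      where pc = esp (refl {p})

    𝟙 : Carrier → Carrier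
    𝟙 p = proj₁ (section-has-greatest p)

{-# OPTIONS --safe #-}
module Submission where

open import Defs
open import Algebra.Core using (Op₂)
open import Algebra.Definitions using (Congruent₂)
open import Axiom.ExcludedMiddle using (ExcludedMiddle)
open import Data.Product using (Σ-syntax; _,_; proj₁; proj₂)
open import Function.Base using (_∘_)
open import Function.Bundles using (_⇔_; mk⇔)
open import Level using (Level)
open import Relation.Binary.Bundles using (Poset)
open import Relation.Binary.Definitions using (_Respects_)
open import Relation.Nullary using (¬_; yes; no; contradiction)
open import Relation.Unary using (Pred; _∩_; _≐_)
open import Relation.Unary.Properties using (≐-sym)

-- The set {u ≥ y : u ⊥_y x} is the set defining the pseudocomplement of x in
-- [y) when y ≤ x, and is all of [y) when y ≰ x, since then [y,x] is empty.

-- Being a maximum depends only on the members of a set, so the equivalence can be checked for each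
-- pair x, y separately. If y ≤ x, the maximum condition is exactly the pseudocomplement condition;
-- otherwise it says that `x ⇒ y` is greatest in [y), hence equal to 1_y.

module _ {c ℓ₁ ℓ₂ : Level} (P : Poset c ℓ₁ ℓ₂) where

  open Poset P
  open SectionalPseudocomplement P

  module _ {ℓ ℓ′ : Level} {S : Pred Carrier ℓ} {T : Pred Carrier ℓ′} where

    IsMax-resp-≐ : S ≐ T → ∀ {m} → IsMax S m → IsMax T m
    IsMax-resp-≐ (S⊆T , T⊆S) (m∈S , S≤m) = S⊆T m∈S , S≤m ∘ T⊆S

  module _ {ℓ : Level} {S : Pred Carrier ℓ} where

    IsMax-unique : ∀ {m n} → IsMax S m → IsMax S n → m ≈ n
    IsMax-unique (m∈S , S≤m) (n∈S , S≤n) = antisym (S≤n m∈S) (S≤m n∈S)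

    IsMax-resp-≈ : S Respects _≈_ → IsMax S Respects _≈_
    IsMax-resp-≈ resp m≈n (m∈S , S≤m) =
      resp m≈n m∈S , λ u∈S → trans (S≤m u∈S) (reflexive m≈n)

  -- Orthogonality gives one half of the inner `≐`: common lower bounds in [y) collapse to y. The
  -- other half, that y is itself a common lower bound, comes from y ≤ u and y ≤ x.
  ⊥-set-above : ∀ {x y} → y ≤ x →
    ([ y ⟩ ∩ (λ u → u ⊥[ y ] x)) ≐
    ([ y ⟩ ∩ (λ u → CommonLowerBounds y u x ≐ ⟦ y ⟧))
  ⊥-set-above y≤x =
      (λ (y≤u , u⊥x) → y≤u
        , (λ (y≤z , z≤u , z≤x) → u⊥x ((y≤z , z≤u) , (y≤z , z≤x)))
        , (λ z≈y → reflexive (Eq.sym z≈y)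
                 , trans (reflexive z≈y) y≤u
                 , trans (reflexive z≈y) y≤x))
    , (λ (y≤u , clb⊆y , _) → y≤u
        , λ ((y≤z , z≤u) , (_ , z≤x)) → clb⊆y (y≤z , z≤u , z≤x))

  ⊥-set-not-above : ∀ {x y} → ¬ (y ≤ x) →
    ([ y ⟩ ∩ (λ u → u ⊥[ y ] x)) ≐ [ y ⟩
  ⊥-set-not-above y≰x =
      proj₁
    , λ y≤u → y≤u , λ (_ , (y≤z , z≤x)) → contradiction (trans y≤z z≤x) y≰x

theorem5p2 :
    {c ℓ₁ ℓ₂ : Level} → ExcludedMiddle ℓ₂ →
    (P : Poset c ℓ₁ ℓ₂) →
    let open Poset P
        open SectionalPseudocomplement P in
    (_⇒_ : Op₂ Carrier) → Congruent₂ _≈_ _⇒_ →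
    (∀ x y → IsMax ([ y ⟩ ∩ (λ u → u ⊥[ y ] x)) (x ⇒ y))
      ⇔
    (Σ[ esp ∈ IsExtendedSectionalPseudocomplementation _⇒_ ]
      (∀ x y → ¬ (y ≤ x) → (x ⇒ y) ≈ 𝟙 esp y))
theorem5p2 em P _⇒_ _ = mk⇔ to from
  where
  open Poset P
  open SectionalPseudocomplement P

  to : (∀ x y → IsMax ([ y ⟩ ∩ (λ u → u ⊥[ y ] x)) (x ⇒ y)) →
       Σ[ esp ∈ IsExtendedSectionalPseudocomplementation _⇒_ ]
         (∀ x y → ¬ (y ≤ x) → (x ⇒ y) ≈ 𝟙 esp y)
  to max = esp , λ x y y≰x →
    -- Both sides are greatest in [y); the right one is `y ⇒ y` by construction.
    IsMax-unique P (IsMax-resp-≐ P (⊥-set-not-above P y≰x) (max x y))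
                   (proj₂ (section-has-greatest esp y))
    where
    esp : IsExtendedSectionalPseudocomplementation _⇒_
    esp {x} {y} y≤x = IsMax-resp-≐ P (⊥-set-above P y≤x) (max x y)

  from : Σ[ esp ∈ IsExtendedSectionalPseudocomplementation _⇒_ ]
           (∀ x y → ¬ (y ≤ x) → (x ⇒ y) ≈ 𝟙 esp y) →
         ∀ x y → IsMax ([ y ⟩ ∩ (λ u → u ⊥[ y ] x)) (x ⇒ y)
  -- Only this direction must decide y ≤ x: in the converse each conclusion already assumes its own
  -- case.
  from (esp , ⇒≈𝟙) x y with em {y ≤ x}
  ... | yes y≤x = IsMax-resp-≐ P (≐-sym (⊥-set-above P y≤x)) (esp y≤x)
  ... | no  y≰x = IsMax-resp-≐ P (≐-sym (⊥-set-not-above P y≰x))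
                    -- `x ⇒ y` is only `≈` to the greatest element, so maximality is carried across,
                    -- [y) being closed under `≈`.
                    (IsMax-resp-≈ P ≤-respʳ-≈ (Eq.sym (⇒≈𝟙 x y y≰x))
                      (proj₂ (section-has-greatest esp y)))
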